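{- For $7 \le n \le 20$, the zero forcing number of the generalized Petersen graph $P(n,3)$ takes the following values: $Z(P(7,3)) = 6$, $Z(P(8,3)) = 6$, $Z(P(9,3)) = 6$, $Z(P(10,3)) = 8$, $Z(P(11,3)) = 7$, $Z(P(12,3)) = 7$, and $Z(P(n,3)) = 8$ for every integer $n$ with $13 \le n \le 20$.
   Context: Let $G=(V,E)$ be a finite simple graph. Color a subset $S\subseteq V$ black and the remaining vertices white. Color change rule: a black vertex with exactly one white neighbor forces that neighbor to become black. Iterating this rule starting from $S$ until no further force is possible gives the closure $\mathrm{cl}(S)$. The set $S$ is a zero forcing set of $G$ if $\mathrm{cl}(S)=V$, and the zero forcing number $Z(G)$ is the minimum cardinality of a zero forcing set. For $n\ge 3$ and $1\le k<n/2$, the generalized Petersen graph $P(n,k)$ has the $2n$ vertices $\{u_0,\dots,u_{n-1}\}\cup\{v_0,\dots,v_{n-1}\}$ and edges $u_i\sim u_{i+1}$, $u_i\sim v_i$, and $v_i\sim v_{i+k}$ for all $i$, with indices taken modulo $n$. -}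

module Defs where

open import Data.Nat using (ℕ; _+_; _*_; _∸_; _≤_; _<_; s≤s; z≤n)
open import Data.Nat.Properties
open import Data.Nat.DivMod using (_%_; _mod_; m%n<n; m<n⇒m%n≡m; m≤n⇒[n∸m]%m≡n%m)
open import Data.Fin using (Fin; toℕ; splitAt)
open import Data.Fin.Properties as Fin using (nonZeroIndex; toℕ<n; toℕ-fromℕ<)
open import Data.Fin.Subset using (Subset; _∈_; _∉_; _∪_; ⁅_⁆; ⊤; ∣_∣)
open import Data.Product using (∃-syntax; _×_)
open import Data.Sum using (_⊎_; inj₁; inj₂; swap)
open import Relation.Nullary using (¬_; yes; no)
open import Relation.Nullary.Decidable using (_⊎-dec_)
open import Relation.Binary.Definitions using (Symmetric; Irreflexive; Decidable)
open import Relation.Binary.Construct.Closure.ReflexiveTransitive using (Star)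
open import Relation.Binary.PropositionalEquality

record SimpleGraph : Set₁ where
  field
    order       : ℕ
    Adj         : Fin order → Fin order → Set
    symmetric   : Symmetric Adj
    irreflexive : Irreflexive _≡_ Adj
    adjacent?   : Decidable Adj

module _ (G : SimpleGraph) where
  open SimpleGraph G

  -- A `Subset` is the set of black vertices of a colouring.

  WhiteNeighbour : Subset order → Fin order → Fin order → Set
  WhiteNeighbour S b w = Adj b w × w ∉ S

  Forces : Subset order → Fin order → Fin order → Set
  Forces S b w = b ∈ S × WhiteNeighbour S b w
               × (∀ {x} → WhiteNeighbour S b x → w ≡ x)

  Step : Subset order → Subset order → Set
  Step S T = ∃[ b ] ∃[ w ] (Forces S b w × T ≡ S ∪ ⁅ w ⁆)

  Stalled : Subset order → Set
  Stalled T = ¬ (∃[ b ] ∃[ w ] Forces T b w)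

  -- `IsClosure S T` says T = cl(S).  The closure is presented as a relation
  -- because the order of the forces is free; T does not depend on that order.
  IsClosure : Subset order → Subset order → Set
  IsClosure S T = Star Step S T × Stalled T

  IsZeroForcing : Subset order → Set
  IsZeroForcing S = IsClosure S ⊤

  IsZeroForcingNumber : ℕ → Set
  IsZeroForcingNumber z =
    (∃[ S ] (IsZeroForcing S × ∣ S ∣ ≡ z)) ×
    (∀ S → IsZeroForcing S → z ≤ ∣ S ∣)

record PetersenParameters (n k : ℕ) : Set where
  field
    3≤n  : 3 ≤ n
    1≤k  : 1 ≤ k
    2k<n : 2 * k < n

  1<n : 1 < n
  1<n = ≤-trans (s≤s (s≤s z≤n)) 3≤n

  k<n : k < n
  k<n = ≤-<-trans (m≤m+n k _) 2k<n

-- Index addition modulo n.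
infixl 6 _⊕_
_⊕_ : ∀ {n} → Fin n → ℕ → Fin n
_⊕_ {n} i m = _mod_ (toℕ i + m) n {{nonZeroIndex i}}

i≢i⊕m : ∀ {n m} (i : Fin n) → 1 ≤ m → m < n → i ≢ i ⊕ m
i≢i⊕m {n} {m} i 1≤m m<n eq with toℕ i + m <? n
... | yes i+m<n = <⇒≢ (m<m+n (toℕ i) 1≤m) (trans toℕ-eq (m<n⇒m%n≡m i+m<n))
  where
  instance _ = nonZeroIndex i
  toℕ-eq : toℕ i ≡ (toℕ i + m) % n
  toℕ-eq = trans (cong toℕ eq) (toℕ-fromℕ< (m%n<n (toℕ i + m) n))
... | no i+m≮n = <⇒≢ wrapped<i (sym (trans toℕ-eq
                   (trans (sym (m≤n⇒[n∸m]%m≡n%m n≤i+m)) (m<n⇒m%n≡m (<-trans wrapped<i (toℕ<n i))))))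
  where
  instance _ = nonZeroIndex i
  n≤i+m : n ≤ toℕ i + m
  n≤i+m = ≮⇒≥ i+m≮n
  toℕ-eq : toℕ i ≡ (toℕ i + m) % n
  toℕ-eq = trans (cong toℕ eq) (toℕ-fromℕ< (m%n<n (toℕ i + m) n))
  wrapped<i : toℕ i + m ∸ n < toℕ i
  wrapped<i = +-cancelʳ-< n _ _
    (subst (_< toℕ i + n) (sym (m∸n+n≡m n≤i+m)) (+-monoʳ-< (toℕ i) m<n))

module _ (n k : ℕ) where

  pattern u i = inj₁ i
  pattern v i = inj₂ i

  PetersenVertex : Set
  PetersenVertex = Fin n ⊎ Fin n

  PetersenAdj : PetersenVertex → PetersenVertex → Set
  PetersenAdj (u i) (u j) = j ≡ i ⊕ 1 ⊎ i ≡ j ⊕ 1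
  PetersenAdj (u i) (v j) = i ≡ j
  PetersenAdj (v i) (u j) = j ≡ i
  PetersenAdj (v i) (v j) = j ≡ i ⊕ k ⊎ i ≡ j ⊕ k

  petersenAdj-sym : Symmetric PetersenAdj
  petersenAdj-sym {u i} {u j} = swap
  petersenAdj-sym {u i} {v j} e = e
  petersenAdj-sym {v i} {u j} e = e
  petersenAdj-sym {v i} {v j} = swap

  petersenAdj-irrefl : PetersenParameters n k → ∀ x → ¬ PetersenAdj x x
  petersenAdj-irrefl p (u i) (inj₁ e) = i≢i⊕m i (s≤s z≤n) (PetersenParameters.1<n p) e
  petersenAdj-irrefl p (u i) (inj₂ e) = i≢i⊕m i (s≤s z≤n) (PetersenParameters.1<n p) e
  petersenAdj-irrefl p (v i) (inj₁ e) =
    i≢i⊕m i (PetersenParameters.1≤k p) (PetersenParameters.k<n p) e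
  petersenAdj-irrefl p (v i) (inj₂ e) =
    i≢i⊕m i (PetersenParameters.1≤k p) (PetersenParameters.k<n p) e

  petersenAdj? : Decidable PetersenAdj
  petersenAdj? (u i) (u j) = (j Fin.≟ i ⊕ 1) ⊎-dec (i Fin.≟ j ⊕ 1)
  petersenAdj? (u i) (v j) = i Fin.≟ j
  petersenAdj? (v i) (u j) = j Fin.≟ i
  petersenAdj? (v i) (v j) = (j Fin.≟ i ⊕ k) ⊎-dec (i Fin.≟ j ⊕ k)

-- The vertices u₀, …, uₙ₋₁ are numbered 0, …, n-1 and v₀, …, vₙ₋₁ are
-- numbered n, …, 2n-1; `splitAt n` decodes this numbering.
P : (n k : ℕ) → PetersenParameters n k → SimpleGraph
P n k p = record
  { order       = n + n
  ; Adj         = λ x y → PetersenAdj n k (splitAt n x) (splitAt n y)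
  ; symmetric   = λ {x} {y} → petersenAdj-sym n k {splitAt n x} {splitAt n y}
  ; irreflexive = λ { {x} refl → petersenAdj-irrefl n k p (splitAt n x) }
  ; adjacent?   = λ x y → petersenAdj? n k (splitAt n x) (splitAt n y)
  }

parameters₃ : ∀ {n} → 7 ≤ n → PetersenParameters n 3
parameters₃ 7≤n = record
  { 3≤n  = ≤-trans (s≤s (s≤s (s≤s z≤n))) 7≤n
  ; 1≤k  = s≤s z≤n
  ; 2k<n = 7≤n
  }

{-# OPTIONS --safe #-}

-- Let S be a zero forcing set with at most r vertices and C a set of vertices,
-- of which S ∖ C accounts for a budget r.  Unless S ∪ C is everything, some force
-- b → w of the process has w ∉ C while b and all its other neighbours lie in
-- S ∪ C.  So all but one of the vertices of N[b] ∖ C belong to S, and C may be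
-- enlarged to N[b] ∪ C at the price |N[b] ∖ C| - 1.  Trying every b, starting from
-- C = ∅ and closing under forces on the way, gives a search tree whose
-- depth is bounded by the budget; S cannot exist if every leaf leaves more
-- white vertices than its budget.  By rotation the first b is u₀ or v₀.  For
-- each n the tree has a few thousand nodes and is refuted by evaluation.

module Submission where

open import Data.Bool using (Bool; true; false; T; _∧_; _∨_; if_then_else_)
open import Data.Bool.ListAction using (all)
open import Data.Bool.Properties using (T-≡; T-∧; T-∨; T?)
open import Data.Empty using (⊥-elim)
open import Data.Fin using (Fin; zero; toℕ; splitAt; join)
open import Data.Fin.Properties as Fin
  using (any?; all?; nonZeroIndex; toℕ-injective; toℕ<n; toℕ-fromℕ<; splitAt-join; join-splitAt)
open import Data.Fin.Subset using (Subset; _∈_; _∪_; _-_; ⁅_⁆; ⊤; ∣_∣)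
open import Data.Fin.Subset.Properties
  using (_∈?_; ∈⊤; x∈⁅y⁆⇒x≡y; x∈p∪q⁻; x∈p⇒∣p-x∣<∣p∣; x∈p∧x≢y⇒x∈p-y; ⊆⊤; ⊆-antisym; ∣⊤∣≡n; ∣p∣≡n⇒p≡⊤)
open import Data.List using (List; []; _∷_; map; length; filter; allFin; upTo)
open import Data.List.Membership.Propositional using () renaming (_∈_ to _∈ᴸ_)
open import Data.List.Membership.Propositional.Properties using (∈-map⁺; ∈-filter⁺; ∈-filter⁻; ∈-allFin)
open import Data.List.Properties using (map-∘)
import Data.List.Relation.Unary.All as All
open import Data.List.Relation.Unary.All.Properties using (all⁺)
open import Data.List.Relation.Unary.Any using (here; there)
open import Data.Nat as ℕ using (ℕ; suc; _+_; _∸_; _≤_; _<_; _<ᵇ_; _≡ᵇ_; s≤s)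
open import Data.Nat.Binary using (ℕᵇ; 2[1+_]; 1+[2_]; fromℕ) renaming (zero to 0ᵇ)
open import Data.Nat.DivMod using (_%_; m%n<n; m<n⇒m%n≡m; %-distribˡ-+; m%n%n≡m%n; [m+n]%n≡m%n)
open import Data.Nat.Properties
open import Data.List.Membership.DecPropositional _≟_ using () renaming (_∈?_ to _∈ᴸ?_)
open import Data.Product using (∃; ∃-syntax; _×_; _,_; proj₁; proj₂)
open import Data.Sum as Sum using (_⊎_; inj₁; inj₂; [_,_]′)
open import Data.Vec using (tabulate)
open import Function using (_∘_; id; Equivalence; case_of_)
open import Relation.Binary.Construct.Closure.ReflexiveTransitive using (Star; ε; _◅_; _◅◅_)
open import Relation.Binary.PropositionalEquality
open import Relation.Nullary using (¬_; Dec; yes; no; does; contradiction)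
open import Relation.Nullary.Decidable using (_×-dec_; _→-dec_; _⊎-dec_; ¬?; map′; decidable-stable)
open import Relation.Unary using (Pred; Decidable) renaming (_⊆_ to _⇒_)
open import Level using (0ℓ)
open import Defs

-- Colourings as tries and the refutation search on them.

-- A set of vertex numbers as a binary trie, for logarithmic lookup during
-- evaluation.
data Colouring : Set where
  ∅    : Colouring
  node : Colouring → Bool → Colouring → Colouring

isBlack : Colouring → ℕᵇ → Bool
isBlack ∅            _       = false
isBlack (node _ c _) 0ᵇ      = c
isBlack (node l _ _) 2[1+ k ] = isBlack l k
isBlack (node _ _ r) 1+[2 k ] = isBlack r k

insert : ℕᵇ → Colouring → Colouring
insert 0ᵇ       ∅            = node ∅ true ∅
insert 2[1+ k ] ∅            = node (insert k ∅) false ∅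
insert 1+[2 k ] ∅            = node ∅ false (insert k ∅)
insert 0ᵇ       (node l _ r) = node l true r
insert 2[1+ k ] (node l c r) = node (insert k l) c r
insert 1+[2 k ] (node l c r) = node l c (insert k r)

infix 4 _⊑_
_⊑_ : Colouring → Colouring → Set
C ⊑ D = ∀ k → T (isBlack C k) → T (isBlack D k)

insert-black : ∀ k C → T (isBlack (insert k C) k)
insert-black 0ᵇ       ∅            = _
insert-black 2[1+ k ] ∅            = insert-black k ∅
insert-black 1+[2 k ] ∅            = insert-black k ∅
insert-black 0ᵇ       (node _ _ _) = _
insert-black 2[1+ k ] (node l _ _) = insert-black k l
insert-black 1+[2 k ] (node _ _ r) = insert-black k r

⊑-insert : ∀ k C → C ⊑ insert k C
⊑-insert 0ᵇ       (node _ _ _) 0ᵇ       _ = _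
⊑-insert 0ᵇ       (node _ _ _) 2[1+ _ ] b = b
⊑-insert 0ᵇ       (node _ _ _) 1+[2 _ ] b = b
⊑-insert 2[1+ _ ] (node _ _ _) 0ᵇ       b = b
⊑-insert 2[1+ k ] (node l _ _) 2[1+ j ] b = ⊑-insert k l j b
⊑-insert 2[1+ _ ] (node _ _ _) 1+[2 _ ] b = b
⊑-insert 1+[2 _ ] (node _ _ _) 0ᵇ       b = b
⊑-insert 1+[2 _ ] (node _ _ _) 2[1+ _ ] b = b
⊑-insert 1+[2 k ] (node _ _ r) 1+[2 j ] b = ⊑-insert k r j b

recount : Colouring × ℕ → Colouring × ℕ
recount (C , c) = C , suc c

-- The second component counts the keys that were white.
blacken : List ℕᵇ → Colouring → Colouring × ℕ
blacken []       C = C , 0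
blacken (k ∷ ks) C = if isBlack C k then blacken ks C else recount (blacken ks (insert k C))

⊑-blacken : ∀ ks C → C ⊑ proj₁ (blacken ks C)
⊑-blacken []       C _ b = b
⊑-blacken (k ∷ ks) C j b with isBlack C k
... | true  = ⊑-blacken ks C j b
... | false = ⊑-blacken ks (insert k C) j (⊑-insert k C j b)

Table : Set
Table = List (ℕᵇ × List ℕᵇ)

mutual
  sweep : Table → Bool → Colouring → Colouring × Bool
  sweep []             changed C = C , changed
  sweep ((b , ns) ∷ t) changed C =
    if isBlack C b then forceFrom t changed C (blacken ns C) else sweep t changed C

  forceFrom : Table → Bool → Colouring → Colouring × ℕ → Colouring × Bool
  -- A count of 1 means exactly one white neighbour, so the force is legal, and `D` already has its
  -- target blackened.
  forceFrom t _       _ (D , 1) = sweep t true D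
  forceFrom t changed C _       = sweep t changed C

-- Each sweep that reports a change has blackened a vertex, so fuel equal to the number of vertices
-- reaches the closure.
saturate : ℕ → Table → Colouring × Bool → Colouring
saturate (suc m) t (C , true) = saturate m t (sweep t false C)
saturate _         _ (C , _)    = C

mutual
  ⊑-sweep : ∀ t c C → C ⊑ proj₁ (sweep t c C)
  ⊑-sweep []             c C k b = b
  ⊑-sweep ((a , ns) ∷ t) c C k b with isBlack C a
  ... | true  = ⊑-forceFrom t c C (blacken ns C) (⊑-blacken ns C) k b
  ... | false = ⊑-sweep t c C k b

  ⊑-forceFrom : ∀ t c C p → C ⊑ proj₁ p → C ⊑ proj₁ (forceFrom t c C p)
  ⊑-forceFrom t c C (D , 0)                 C⊑D k b = ⊑-sweep t c C k b
  ⊑-forceFrom t c C (D , 1)                 C⊑D k b = ⊑-sweep t true D k (C⊑D k b)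
  ⊑-forceFrom t c C (D , suc (suc _)) C⊑D k b = ⊑-sweep t c C k b

-- Growth is what soundness asks of saturation: enlarging the colouring keeps the seed known without
-- touching the budget.
⊑-saturate : ∀ m t p → proj₁ p ⊑ saturate m t p
⊑-saturate ℕ.zero    t (C , _)     k b = b
⊑-saturate (suc m) t (C , false) k b = b
⊑-saturate (suc m) t (C , true)  k b =
  ⊑-saturate m t (sweep t false C) k (⊑-sweep t false C k b)

-- `search` and `branch` answer true when the subtree is refuted.  The first
-- argument is fuel; running out of it counts as failure.
mutual
  search : ℕ → Table → ℕ → Colouring → Bool
  search ℕ.zero    _ _ _ = false
  search (suc d) t r C =
    (r <ᵇ proj₂ (blacken (map proj₁ t) C)) ∧ all (branch d t r C) t

  branch : ℕ → Table → ℕ → Colouring → ℕᵇ × List ℕᵇ → Bool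
  branch d t r C (b , ns) = all (isBlack C) ns ∨ continue d t r (blacken (b ∷ ns) C)

  continue : ℕ → Table → ℕ → Colouring × ℕ → Bool
  continue d t r (D , c) =
    (suc r <ᵇ c) ∨ search d t (suc r ∸ c) (saturate (length t) t (D , true))

-- Exhausting seeds and their transport along automorphisms.

module _ (G : SimpleGraph) where
  open SimpleGraph G

  private
    V : Set
    V = Fin order

  Forcing : Pred V 0ℓ → Set
  Forcing K = ∃[ b ] ∃[ w ] (Adj b w × ¬ K w × K b × (∀ {x} → Adj b x → x ≢ w → K x))

  -- The only property of the seed of a zero forcing process that the lower bound
  -- needs; unlike the process itself it is easily moved along automorphisms.
  Exhausting : Pred V 0ℓ → Set₁
  Exhausting A = ∀ (K : Pred V 0ℓ) → Decidable K → A ⇒ K → (∀ x → K x) ⊎ Forcing K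

  -- Follow the process to the first force whose target `w` lies outside `K`. Up to then every black
  -- vertex lies in `K`; this includes `b` and, by uniqueness of its white neighbour, all its
  -- neighbours other than `w`.
  zeroForcing⇒exhausting : ∀ {S} → Star (Step G) S ⊤ → Exhausting (_∈ S)
  zeroForcing⇒exhausting ε K K? S⊆K = inj₁ λ _ → S⊆K ∈⊤
  zeroForcing⇒exhausting {S} ((b , w , (b∈S , (b~w , _) , unique) , refl) ◅ steps) K K? S⊆K
    with K? w
  ... | yes Kw = zeroForcing⇒exhausting steps K K? λ x∈ →
    [ S⊆K , (λ x∈⁅w⁆ → subst K (sym (x∈⁅y⁆⇒x≡y w x∈⁅w⁆)) Kw) ]′ (x∈p∪q⁻ S ⁅ w ⁆ x∈)
  ... | no ¬Kw = inj₂ (b , w , b~w , ¬Kw , S⊆K b∈S , λ {x} b~x x≢w →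
    S⊆K (decidable-stable (x ∈? S) λ x∉S → x≢w (sym (unique (b~x , x∉S)))))

  record Automorphism : Set where
    field
      to from   : V → V
      to∘from   : ∀ x → to (from x) ≡ x
      from∘to   : ∀ x → from (to x) ≡ x
      to-Adj    : ∀ {x y} → Adj x y → Adj (to x) (to y)
      from-Adj  : ∀ {x y} → Adj x y → Adj (from x) (from y)

    to-injective : ∀ {x y} → to x ≡ to y → x ≡ y
    to-injective {x} {y} eq = trans (sym (from∘to x)) (trans (cong from eq) (from∘to y))

    forcing-from : ∀ {K : Pred V 0ℓ} → Forcing (K ∘ from) → Forcing K
    forcing-from {K} (b , w , b~w , ¬Kw , Kb , others) =
      from b , from w , from-Adj b~w , ¬Kw , Kb , λ {x} b~x x≢w →
        subst K (from∘to x)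
          (others (subst (λ z → Adj z (to x)) (to∘from b) (to-Adj b~x))
                  (λ eq → x≢w (trans (sym (from∘to x)) (cong from eq))))

    exhausting-∘ : ∀ {A} → Exhausting A → Exhausting (A ∘ to)
    exhausting-∘ {A} exh K K? A⊆K with
      exh (K ∘ from) (K? ∘ from) (λ {x} Ax → A⊆K (subst A (sym (to∘from x)) Ax))
    ... | inj₁ full = inj₁ λ x → subst K (from∘to x) (full (to x))
    ... | inj₂ f    = inj₂ (forcing-from f)

  -- Soundness of the search.

  neighbours : V → List V
  neighbours b = filter (adjacent? b) (allFin order)

  key : V → ℕᵇ
  key = fromℕ ∘ toℕ

  entry : V → ℕᵇ × List ℕᵇ
  entry b = key b , map key (neighbours b)

  table : Table
  table = map entry (allFin order)

  module _ (f : V → V) (f-injective : ∀ {x y} → f x ≡ f y → x ≡ y) where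

    -- The search works in coordinates moved by f, so that it may start at a
    -- fixed vertex; R is the part of the seed that has not been paid for.
    Known : Colouring → Subset order → Pred V 0ℓ
    Known C R x = T (isBlack C (key x)) ⊎ f x ∈ R

    known? : ∀ C R → Decidable (Known C R)
    known? C R x = T? (isBlack C (key x)) ⊎-dec (f x ∈? R)

    known-⊑ : ∀ C D {R} → C ⊑ D → Known C R ⇒ Known D R
    known-⊑ C D C⊑D = Sum.map₁ (C⊑D _)

    known-insert : ∀ C {R} y → Known C R ⇒ Known (insert (key y) C) (R - f y)
    known-insert C y (inj₁ black) = inj₁ (⊑-insert (key y) C _ black)
    known-insert C y {x} (inj₂ fx∈R) with x Fin.≟ y
    ... | yes refl = inj₁ (insert-black (key y) C)
    ... | no x≢y   = inj₂ (x∈p∧x≢y⇒x∈p-y fx∈R (x≢y ∘ f-injective))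

    -- A listed vertex that is still white can only be known through `R`. Removing its image from
    -- `R` when it is blackened pays for one unit of the count; injectivity of `f` protects all
    -- other vertices.
    blacken-known : ∀ ys C R → (∀ {y} → y ∈ᴸ ys → Known C R y) → let (D , c) = blacken (map key ys) C in
                    ∃[ R′ ] (Known C R ⇒ Known D R′ × ∣ R′ ∣ + c ≤ ∣ R ∣)
    blacken-known []       C R _     = R , id , ≤-reflexive (+-identityʳ _)
    blacken-known (y ∷ ys) C R known with isBlack C (key y) in eq
    ... | true  = blacken-known ys C R (known ∘ there)
    ... | false =
      let fy∈R = [ (λ black → ⊥-elim (subst T eq black)) , id ]′ (known (here refl))
          R′ , keep , bound = blacken-known ys (insert (key y) C) (R - f y) (known-insert C y ∘ known ∘ there)
      in R′ , keep ∘ known-insert C y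
       , ≤-trans (≤-reflexive (+-suc _ _)) (≤-trans (s≤s bound) (x∈p⇒∣p-x∣<∣p∣ fy∈R))

    -- This yields the price of a branch: all of N[b] is known except possibly the target `w`, which
    -- is blackened for free and accounts for the `suc`.
    blacken-known-but-one : ∀ {w} ys C R → (∀ {y} → y ∈ᴸ ys → y ≢ w → Known C R y) →
                    let (D , c) = blacken (map key ys) C in
                    ∃[ R′ ] (Known C R ⇒ Known D R′ × ∣ R′ ∣ + c ≤ suc ∣ R ∣)
    blacken-known-but-one []       C R _     = R , id , ≤-trans (≤-reflexive (+-identityʳ _)) (n≤1+n _)
    blacken-known-but-one {w} (y ∷ ys) C R known with isBlack C (key y) in eq
    ... | true  = blacken-known-but-one ys C R (known ∘ there)
    ... | false with y Fin.≟ w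
    -- The free vertex is reached. Once it is black, the rest of the list is known, repetitions of
    -- it included, and `blacken-known` applies.
    ...   | yes refl =
      let C⁺ = insert (key y) C
          grow : Known C R ⇒ Known C⁺ R
          grow = known-⊑ C C⁺ (⊑-insert (key y) C)
          rest-known : ∀ {x} → x ∈ᴸ ys → Known C⁺ R x
          rest-known {x} x∈ys = case x Fin.≟ y of λ where
            (yes refl) → inj₁ (insert-black (key y) C)
            (no x≢y)   → grow (known (there x∈ys) x≢y)
          R′ , keep , bound = blacken-known ys C⁺ R rest-known
      in R′ , keep ∘ grow , ≤-trans (≤-reflexive (+-suc _ _)) (s≤s bound)
    ...   | no y≢w =
      let fy∈R = [ (λ black → ⊥-elim (subst T eq black)) , id ]′ (known (here refl) y≢w)
          R′ , keep , bound = blacken-known-but-one ys (insert (key y) C) (R - f y)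
                                (λ x∈ys x≢w → known-insert C y (known (there x∈ys) x≢w))
      in R′ , keep ∘ known-insert C y
       , ≤-trans (≤-reflexive (+-suc _ _)) (s≤s (≤-trans bound (x∈p⇒∣p-x∣<∣p∣ fy∈R)))

    module _ {A : Pred V 0ℓ} (exhausting : Exhausting A) where

      mutual
        search-sound : ∀ d r C R → T (search d table r C) → A ⇒ Known C R → ¬ ∣ R ∣ ≤ r
        search-sound (suc d) r C R ok A⊆K ∣R∣≤r
          with Equivalence.to T-∧ ok
        ... | large , branches with exhausting (Known C R) (known? C R) A⊆K
        -- If everything is known, each white vertex costs an element of `R`, but `large` says that
        -- there are more than `r` of them.
        ...   | inj₁ full =
          let R′ , _ , bound = blacken-known (allFin order) C R (λ {y} _ → full y)
              whites = proj₂ (blacken (map key (allFin order)) C)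
              keys≡ : map key (allFin order) ≡ map proj₁ table
              keys≡ = map-∘ (allFin order)
          in <⇒≱ (<ᵇ⇒< r whites (subst (λ ks → T (r <ᵇ proj₂ (blacken ks C))) (sym keys≡) large))
               (≤-trans (m+n≤o⇒n≤o ∣ R′ ∣ bound) ∣R∣≤r)
        ...   | inj₂ (b , force) =
          branch-sound d r C R b
            (All.lookup (all⁺ (branch d table r C) table branches) (∈-map⁺ entry (∈-allFin b)))
            A⊆K force ∣R∣≤r

        branch-sound : ∀ d r C R b → T (branch d table r C (entry b)) → A ⇒ Known C R →
          ∃[ w ] (Adj b w × ¬ Known C R w × Known C R b × (∀ {x} → Adj b x → x ≢ w → Known C R x)) →
          ¬ ∣ R ∣ ≤ r
        branch-sound d r C R b ok A⊆K (w , b~w , ¬Kw , Kb , others) ∣R∣≤r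
          with Equivalence.to (T-∨ {x = all (isBlack C) (map key (neighbours b))}) ok
        ... | inj₁ black =
          -- A branch with all neighbours of `b` black offers no unknown target `w`.
          ¬Kw (inj₁ (All.lookup (all⁺ (isBlack C) _ black)
            (∈-map⁺ key (∈-filter⁺ (adjacent? b) (∈-allFin w) b~w))))
        ... | inj₂ ok′ with blacken-known-but-one {w} (b ∷ neighbours b) C R
          (λ { (here refl) _ → Kb
             ; (there y∈) y≢w → others (proj₂ (∈-filter⁻ (adjacent? b) {xs = allFin order} y∈)) y≢w })
        ...   | R′ , keep , bound with blacken (key b ∷ map key (neighbours b)) C
        ...     | D , c with Equivalence.to (T-∨ {x = suc r <ᵇ c}) ok′
        ...       | inj₁ overspent =
          <⇒≱ (<ᵇ⇒< (suc r) c overspent) (≤-trans (m+n≤o⇒n≤o ∣ R′ ∣ bound) (s≤s ∣R∣≤r))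
        ...       | inj₂ ok″ =
          search-sound d (suc r ∸ c) _ R′ ok″
            (known-⊑ D (saturate (length table) table (D , true))
              (⊑-saturate (length table) table (D , true)) ∘ keep ∘ A⊆K)
            (m+n≤o⇒m≤o∸n ∣ R′ ∣ (≤-trans bound (s≤s ∣R∣≤r)))

  refuted : ℕ → List V → Bool
  -- After saturation a branch not closed at once blackens at least two vertices: two white
  -- neighbours of a black `b`, or a white `b` and a white neighbour. The budget therefore drops at
  -- every level, and `2 + r` is ample fuel.
  refuted r bs = (r <ᵇ order) ∧ all (branch (2 + r) table r ∅ ∘ entry) bs

  -- Taking `K` to be the seed itself gives a force available at the start. An automorphism carries
  -- a representative `b₀` to its source `b`, so in coordinates moved by `φ` the search may begin at
  -- `b₀`, with nothing black and the whole seed unpaid.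
  refuted-sound : ∀ r bs → (∀ b → ∃[ b₀ ] (b₀ ∈ᴸ bs × ∃[ φ ] (Automorphism.to φ b₀ ≡ b))) →
                  T (refuted r bs) → ∀ S → IsZeroForcing G S → r < ∣ S ∣
  refuted-sound r bs orbits ok S ((steps , _)) = ≰⇒> λ ∣S∣≤r → go ∣S∣≤r
    where
    exh : Exhausting (_∈ S)
    exh = zeroForcing⇒exhausting steps
    go : ¬ ∣ S ∣ ≤ r
    go ∣S∣≤r with Equivalence.to T-∧ ok
    ... | r<order , branches with exh (_∈ S) (_∈? S) id
    ...   | inj₁ full =
      <⇒≱ (<ᵇ⇒< r order r<order)
        (≤-trans (≤-reflexive (sym (trans (cong ∣_∣ (⊆-antisym ⊆⊤ λ _ → full _)) (∣⊤∣≡n order)))) ∣S∣≤r)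
    ...   | inj₂ (b , w , b~w , w∉S , b∈S , others) with orbits b
    ...     | b₀ , b₀∈bs , φ , refl =
      branch-sound to to-injective (exhausting-∘ exh) (2 + r) r ∅ S b₀
        (All.lookup (all⁺ (branch (2 + r) table r ∅ ∘ entry) bs branches) b₀∈bs) inj₂
        ( from w
        , subst (λ z → Adj z (from w)) (from∘to b₀) (from-Adj b~w)
        , (λ { (inj₂ w∈S) → w∉S (subst (_∈ S) (to∘from w) w∈S) })
        , inj₂ b∈S
        , λ b~x x≢w → inj₂ (others (to-Adj b~x) λ eq → x≢w (trans (sym (from∘to _)) (cong from eq))))
        ∣S∣≤r
      where open Automorphism φ

  -- Upper bounds by running the forcing process.

  forces? : ∀ S b → Dec (∃[ w ] Forces G S b w)
  forces? S b = any? λ w →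
    (b ∈? S) ×-dec white? w ×-dec
    map′ (λ h {x} → h x) (λ h x → h {x}) (all? λ x → white? x →-dec (w Fin.≟ x))
    where
    white? : ∀ x → Dec (WhiteNeighbour G S b x)
    white? x = adjacent? b x ×-dec ¬? (x ∈? S)

  forceInTurn : List V → ∀ S → ∃ (Star (Step G) S)
  forceInTurn []       S = S , ε
  forceInTurn (b ∷ bs) S with forces? S b
  ... | no _        = forceInTurn bs S
  ... | yes (w , f) = let T , steps = forceInTurn bs (S ∪ ⁅ w ⁆) in T , (b , w , f , refl) ◅ steps

  forceRounds : ℕ → ∀ S → ∃ (Star (Step G) S)
  forceRounds ℕ.zero    S = S , ε
  forceRounds (suc m) S =
    let T , steps = forceInTurn (allFin order) S ; U , steps′ = forceRounds m T in U , steps ◅◅ steps′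

  ⊤-stalled : Stalled G ⊤
  ⊤-stalled (_ , _ , _ , (_ , w∉⊤) , _) = w∉⊤ ∈⊤

  forceRounds-zeroForcing : ∀ m S → proj₁ (forceRounds m S) ≡ ⊤ → IsZeroForcing G S
  forceRounds-zeroForcing m S eq = subst (Star (Step G) S) eq (proj₂ (forceRounds m S)) , ⊤-stalled

  -- Stated with ≡ true: a goal T (certified …) would be evaluated several times.
  -- Three rounds suffice for all the seeds below.
  certified : ℕ → Subset order → List V → Bool
  certified r S bs =
    (∣ S ∣ ≡ᵇ suc r) ∧ (∣ proj₁ (forceRounds 3 S) ∣ ≡ᵇ order) ∧ refuted r bs

  certified-sound : ∀ r S bs → (∀ b → ∃[ b₀ ] (b₀ ∈ᴸ bs × ∃[ φ ] (Automorphism.to φ b₀ ≡ b))) →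
                    certified r S bs ≡ true → IsZeroForcingNumber G (suc r)
  certified-sound r S bs orbits cert =
    let size , cert′  = Equivalence.to (T-∧ {∣ S ∣ ≡ᵇ suc r}) (Equivalence.from T-≡ cert)
        full , refute = Equivalence.to (T-∧ {∣ proj₁ (forceRounds 3 S) ∣ ≡ᵇ order}) cert′
    in ( S
       , forceRounds-zeroForcing 3 S (∣p∣≡n⇒p≡⊤ (≡ᵇ⇒≡ ∣ proj₁ (forceRounds 3 S) ∣ order full))
       , ≡ᵇ⇒≡ ∣ S ∣ (suc r) size)
     , refuted-sound r bs orbits refute

-- Rotations of generalized Petersen graphs.

toℕ-⊕ : ∀ {n} (i : Fin n) m → let instance _ = nonZeroIndex i in toℕ (i ⊕ m) ≡ (toℕ i + m) % n
toℕ-⊕ {n} i m = toℕ-fromℕ< (m%n<n (toℕ i + m) n)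
  where instance _ = nonZeroIndex i

⊕-assoc : ∀ {n} (i : Fin n) a b → i ⊕ a ⊕ b ≡ i ⊕ (a + b)
⊕-assoc {n} i a b = toℕ-injective (begin
  toℕ (i ⊕ a ⊕ b)                          ≡⟨ toℕ-⊕ (i ⊕ a) b ⟩
  (toℕ (i ⊕ a) + b) % n                    ≡⟨ cong (λ z → (z + b) % n) (toℕ-⊕ i a) ⟩
  ((toℕ i + a) % n + b) % n                ≡⟨ %-distribˡ-+ ((toℕ i + a) % n) b n ⟩
  ((toℕ i + a) % n % n + b % n) % n        ≡⟨ cong (λ z → (z + b % n) % n) (m%n%n≡m%n (toℕ i + a) n) ⟩
  ((toℕ i + a) % n + b % n) % n            ≡⟨ %-distribˡ-+ (toℕ i + a) b n ⟨
  (toℕ i + a + b) % n                      ≡⟨ cong (_% n) (+-assoc (toℕ i) a b) ⟩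
  (toℕ i + (a + b)) % n                    ≡⟨ toℕ-⊕ i (a + b) ⟨
  toℕ (i ⊕ (a + b))                        ∎)
  where
  open ≡-Reasoning
  instance _ = nonZeroIndex i

⊕-comm : ∀ {n} (i : Fin n) a b → i ⊕ a ⊕ b ≡ i ⊕ b ⊕ a
⊕-comm i a b = trans (⊕-assoc i a b) (trans (cong (i ⊕_) (+-comm a b)) (sym (⊕-assoc i b a)))

⊕-period : ∀ {n} (i : Fin n) → i ⊕ n ≡ i
⊕-period {n} i = toℕ-injective
  (trans (toℕ-⊕ i n) (trans ([m+n]%n≡m%n (toℕ i) n) (m<n⇒m%n≡m (toℕ<n i))))
  where instance _ = nonZeroIndex i

⊕-cycle : ∀ {n} (i : Fin n) a b → a + b ≡ n → i ⊕ a ⊕ b ≡ i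
⊕-cycle i a b eq = trans (⊕-assoc i a b) (trans (cong (i ⊕_) eq) (⊕-period i))

zero-⊕ : ∀ {n} (i : Fin (suc n)) → zero ⊕ toℕ i ≡ i
zero-⊕ i = toℕ-injective (trans (toℕ-⊕ zero (toℕ i)) (m<n⇒m%n≡m (toℕ<n i)))

rotateᵖ : ∀ {n} → ℕ → Fin n ⊎ Fin n → Fin n ⊎ Fin n
rotateᵖ m = Sum.map (_⊕ m) (_⊕ m)

rotateᵖ-cycle : ∀ {n} a b → a + b ≡ n → (x : Fin n ⊎ Fin n) → rotateᵖ b (rotateᵖ a x) ≡ x
rotateᵖ-cycle a b eq (inj₁ i) = cong inj₁ (⊕-cycle i a b eq)
rotateᵖ-cycle a b eq (inj₂ i) = cong inj₂ (⊕-cycle i a b eq)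

rotateᵖ-Adj : ∀ n k m x y → PetersenAdj n k x y → PetersenAdj n k (rotateᵖ m x) (rotateᵖ m y)
rotateᵖ-Adj n k m (inj₁ i) (inj₁ j) = Sum.map (shift i) (shift j)
  where
  shift : ∀ i {j} → j ≡ i ⊕ 1 → j ⊕ m ≡ i ⊕ m ⊕ 1
  shift i refl = ⊕-comm i 1 m
rotateᵖ-Adj n k m (inj₁ i) (inj₂ j) = cong (_⊕ m)
rotateᵖ-Adj n k m (inj₂ i) (inj₁ j) = cong (_⊕ m)
rotateᵖ-Adj n k m (inj₂ i) (inj₂ j) = Sum.map (shift i) (shift j)
  where
  shift : ∀ i {j} → j ≡ i ⊕ k → j ⊕ m ≡ i ⊕ m ⊕ k
  shift i refl = ⊕-comm i k m

rotate : ∀ n → ℕ → Fin (n + n) → Fin (n + n)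
rotate n m x = join n n (rotateᵖ m (splitAt n x))

splitAt-rotate : ∀ n m x → splitAt n (rotate n m x) ≡ rotateᵖ m (splitAt n x)
splitAt-rotate n m x = splitAt-join n n _

rotate-cycle : ∀ n a b → a + b ≡ n → ∀ x → rotate n b (rotate n a x) ≡ x
rotate-cycle n a b eq x =
  trans (cong (join n n ∘ rotateᵖ b) (splitAt-rotate n a x))
    (trans (cong (join n n) (rotateᵖ-cycle a b eq (splitAt n x))) (join-splitAt n n x))

rotate-Adj : ∀ n k p m {x y} → let open SimpleGraph (P n k p) in Adj x y → Adj (rotate n m x) (rotate n m y)
rotate-Adj n k p m {x} {y} x~y =
  subst₂ (PetersenAdj n k) (sym (splitAt-rotate n m x)) (sym (splitAt-rotate n m y))
    (rotateᵖ-Adj n k m (splitAt n x) (splitAt n y) x~y)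

rotation : ∀ n k p m → m ≤ n → Automorphism (P n k p)
rotation n k p m m≤n = record
  { to       = rotate n m
  ; from     = rotate n (n ∸ m)
  ; to∘from  = rotate-cycle n (n ∸ m) m (m∸n+n≡m m≤n)
  ; from∘to  = rotate-cycle n m (n ∸ m) (m+[n∸m]≡n m≤n)
  ; to-Adj   = λ {x} {y} → rotate-Adj n k p m {x} {y}
  ; from-Adj = λ {x} {y} → rotate-Adj n k p (n ∸ m) {x} {y}
  }

u₀v₀ : ∀ n → List (Fin (suc n + suc n))
u₀v₀ n = join (suc n) (suc n) (inj₁ zero) ∷ join (suc n) (suc n) (inj₂ zero) ∷ []

rotate-join : ∀ n m x → rotate n m (join n n x) ≡ join n n (rotateᵖ m x)
rotate-join n m x = cong (join n n ∘ rotateᵖ m) (splitAt-join n n x)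

-- Rotation by `i` carries u₀ to uᵢ and v₀ to vᵢ, so these two starting vertices represent all.
u₀v₀-orbits : ∀ n k p b → ∃[ b₀ ] (b₀ ∈ᴸ u₀v₀ n × ∃[ φ ] (Automorphism.to {P (suc n) k p} φ b₀ ≡ b))
u₀v₀-orbits n′ k p b with splitAt (suc n′) b in eq
... | inj₁ i = join n n (inj₁ zero) , here refl , rotation n k p (toℕ i) (<⇒≤ (toℕ<n i)) , (begin
  rotate n (toℕ i) (join n n (inj₁ zero))  ≡⟨ rotate-join n (toℕ i) (inj₁ zero) ⟩
  join n n (inj₁ (zero ⊕ toℕ i))           ≡⟨ cong (join n n ∘ inj₁) (zero-⊕ i) ⟩
  join n n (inj₁ i)                        ≡⟨ cong (join n n) eq ⟨
  join n n (splitAt n b)                   ≡⟨ join-splitAt n n b ⟩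
  b                                        ∎)
  where
  open ≡-Reasoning
  n = suc n′
... | inj₂ i = join n n (inj₂ zero) , there (here refl) , rotation n k p (toℕ i) (<⇒≤ (toℕ<n i)) , (begin
  rotate n (toℕ i) (join n n (inj₂ zero))  ≡⟨ rotate-join n (toℕ i) (inj₂ zero) ⟩
  join n n (inj₂ (zero ⊕ toℕ i))           ≡⟨ cong (join n n ∘ inj₂) (zero-⊕ i) ⟩
  join n n (inj₂ i)                        ≡⟨ cong (join n n) eq ⟨
  join n n (splitAt n b)                   ≡⟨ join-splitAt n n b ⟩
  b                                        ∎)
  where
  open ≡-Reasoning
  n = suc n′

-- Explicit seeds and the values for k = 3.

seed : ∀ n → List ℕ → List ℕ → Subset (n + n)
seed n us vs = tabulate (λ x → [ occurs us , occurs vs ]′ (splitAt n x))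
  where
  occurs : List ℕ → Fin n → Bool
  occurs is i = does (toℕ i ∈ᴸ? is)

-- Both `n` and `r` are one below the actual parameters: `r` is the largest seed size that the
-- search has to refute.
zeroForcingNumber : ∀ n k p r us vs →
                    certified (P (suc n) k p) r (seed (suc n) us vs) (u₀v₀ n) ≡ true →
                    IsZeroForcingNumber (P (suc n) k p) (suc r)
zeroForcingNumber n k p r us vs =
  certified-sound (P (suc n) k p) r (seed (suc n) us vs) (u₀v₀ n) (u₀v₀-orbits n k p)

Z[P7]≡6 : ∀ p → IsZeroForcingNumber (P 7 3 p) 6
Z[P7]≡6 p = zeroForcingNumber 6 3 p 5 (0 ∷ 2 ∷ []) (0 ∷ 2 ∷ 4 ∷ 5 ∷ []) refl

Z[P8]≡6 : ∀ p → IsZeroForcingNumber (P 8 3 p) 6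
Z[P8]≡6 p = zeroForcingNumber 7 3 p 5 (0 ∷ 2 ∷ []) (0 ∷ 2 ∷ 4 ∷ 5 ∷ []) refl

Z[P9]≡6 : ∀ p → IsZeroForcingNumber (P 9 3 p) 6
Z[P9]≡6 p = zeroForcingNumber 8 3 p 5 (0 ∷ 2 ∷ []) (0 ∷ 2 ∷ 4 ∷ 5 ∷ []) refl

Z[P10]≡8 : ∀ p → IsZeroForcingNumber (P 10 3 p) 8
Z[P10]≡8 p = zeroForcingNumber 9 3 p 7 (upTo 2) (upTo 6) refl

Z[P11]≡7 : ∀ p → IsZeroForcingNumber (P 11 3 p) 7
Z[P11]≡7 p = zeroForcingNumber 10 3 p 6 (upTo 2) (upTo 5) refl

Z[P12]≡7 : ∀ p → IsZeroForcingNumber (P 12 3 p) 7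
Z[P12]≡7 p = zeroForcingNumber 11 3 p 6 (upTo 2) (upTo 5) refl

-- One seed serves every case: starting from u₀, u₁ and v₀, ..., v₅, the front runs round the graph,
-- uᵢ forcing uᵢ₊₁ and vᵢ forcing vᵢ₊₃. The lower bound is evaluated separately for each order.
Z[P[13+m]]≡8 : ∀ m → m ≤ 7 → ∀ p → IsZeroForcingNumber (P (13 + m) 3 p) 8
Z[P[13+m]]≡8 0 _ p = zeroForcingNumber 12 3 p 7 (upTo 2) (upTo 6) refl
Z[P[13+m]]≡8 1 _ p = zeroForcingNumber 13 3 p 7 (upTo 2) (upTo 6) refl
Z[P[13+m]]≡8 2 _ p = zeroForcingNumber 14 3 p 7 (upTo 2) (upTo 6) refl
Z[P[13+m]]≡8 3 _ p = zeroForcingNumber 15 3 p 7 (upTo 2) (upTo 6) refl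
Z[P[13+m]]≡8 4 _ p = zeroForcingNumber 16 3 p 7 (upTo 2) (upTo 6) refl
Z[P[13+m]]≡8 5 _ p = zeroForcingNumber 17 3 p 7 (upTo 2) (upTo 6) refl
Z[P[13+m]]≡8 6 _ p = zeroForcingNumber 18 3 p 7 (upTo 2) (upTo 6) refl
Z[P[13+m]]≡8 7 _ p = zeroForcingNumber 19 3 p 7 (upTo 2) (upTo 6) refl
Z[P[13+m]]≡8 (suc (suc (suc (suc (suc (suc (suc (suc m)))))))) m≤7 =
  contradiction m≤7 (<⇒≱ (m≤m+n 8 m))

mainTheorem3 :
    (n : ℕ) (7≤n : 7 ≤ n) → n ≤ 20 →
    (n ≡ 7  → IsZeroForcingNumber (P n 3 (parameters₃ 7≤n)) 6) ×
    (n ≡ 8  → IsZeroForcingNumber (P n 3 (parameters₃ 7≤n)) 6) ×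
    (n ≡ 9  → IsZeroForcingNumber (P n 3 (parameters₃ 7≤n)) 6) ×
    (n ≡ 10 → IsZeroForcingNumber (P n 3 (parameters₃ 7≤n)) 8) ×
    (n ≡ 11 → IsZeroForcingNumber (P n 3 (parameters₃ 7≤n)) 7) ×
    (n ≡ 12 → IsZeroForcingNumber (P n 3 (parameters₃ 7≤n)) 7) ×
    (13 ≤ n → IsZeroForcingNumber (P n 3 (parameters₃ 7≤n)) 8)
mainTheorem3 n 7≤n n≤20 =
  (λ { refl → Z[P7]≡6 (parameters₃ 7≤n) }) ,
  (λ { refl → Z[P8]≡6 (parameters₃ 7≤n) }) ,
  (λ { refl → Z[P9]≡6 (parameters₃ 7≤n) }) ,
  (λ { refl → Z[P10]≡8 (parameters₃ 7≤n) }) ,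
  (λ { refl → Z[P11]≡7 (parameters₃ 7≤n) }) ,
  (λ { refl → Z[P12]≡7 (parameters₃ 7≤n) }) ,
  λ 13≤n → case m≤n⇒∃[o]m+o≡n 13≤n of λ where
    (m , refl) → Z[P[13+m]]≡8 m (+-cancelˡ-≤ 13 m 7 n≤20) (parameters₃ 7≤n)
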